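{- Fix the domain $[n]^d$ and a product distribution $\mathcal{D}$ on $[n]^d$. Suppose there is a $Q$-query tester for a bounded-derivative property $\mathcal{P}(\mathcal{B})$ with respect to $\mathcal{D}$ with proximity parameter $\varepsilon$. Then there is a $(Q+10/\varepsilon)$-query tester for monotonicity of functions $f:[n]^d\to\mathbb{N}$ with respect to $\mathcal{D}$ with proximity parameter $2\varepsilon$.
   Context: A bounding family is a tuple of $2d$ functions $l_1,u_1,\dots,l_d,u_d:[n-1]\to\mathbb{R}$ with $l_r(y)<u_r(y)$; the bounded-derivative property $\mathcal{P}(\mathcal{B})$ is the set of $f:[n]^d\to\mathbb{R}$ with $l_r(x_r)\le f(x+\mathbf{e}_r)-f(x)\le u_r(x_r)$ for all $r$ and $x$ with $x_r<n$. $f$ is monotone if $f(x)\le f(y)$ whenever $x\le y$ coordinatewise. A tester for a property $\mathcal{P}$ w.r.t. $\mathcal{D}$ with proximity parameter $\varepsilon$ has query access to $f$, accepts with probability $>2/3$ if $f\in\mathcal{P}$, and rejects with probability $>2/3$ if $\inf_{g\in\mathcal{P}}\Pr_{x\sim\mathcal{D}}[f(x)\ne g(x)]>\varepsilon$. -}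

module Defs where

open import Algebra.Bundles using (CommutativeRing)
open import Algebra.Structures using (IsCommutativeRing)
open import Data.Bool.Base using (Bool; true; false; if_then_else_)
open import Data.Fin.Base as Fin using (Fin; toℕ; inject₁)
open import Data.Nat.Base as ℕ using (ℕ; zero; suc)
open import Data.Product.Base using (_×_; _,_; ∃-syntax)
open import Data.Vec.Base using (Vec; []; _∷_; lookup; _[_]≔_)
open import Level using (0ℓ)
open import Relation.Binary.Core using (Rel)
open import Relation.Binary.Definitions using (DecidableEquality)
open import Relation.Binary.PropositionalEquality using (_≡_; _≢_)
open import Relation.Binary.Structures using (IsDecTotalOrder)
open import Relation.Nullary.Decidable using (does; ¬?)
open import Relation.Unary using (Pred; Decidable; _∈_; _≐_; _⊥_; U; ∁; ⋃)
import Algebra.Properties.CommutativeMonoid.Sum as Sum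
import Algebra.Properties.Monoid.Mult as Mult
import Relation.Binary.Construct.NonStrictToStrict as Strict

IsInfimum : {A : Set} → Rel A 0ℓ → Pred A 0ℓ → A → Set
IsInfimum _≤_ S m = (∀ s → s ∈ S → m ≤ s) × (∀ b → (∀ s → s ∈ S → b ≤ s) → b ≤ m)

IsSupremum : {A : Set} → Rel A 0ℓ → Pred A 0ℓ → A → Set
IsSupremum _≤_ = IsInfimum (λ x y → y ≤ x)

-- The real numbers, axiomatised (up to isomorphism) as a complete ordered
-- field.  Mathematics over them is classical, so the order is decidable.
-- The value of 0# ⁻¹ is unspecified.
record RealNumbers : Set₁ where
  infixl 6 _+_ _-_
  infixl 7 _*_ _/_
  infix  8 -_
  infix  9 _⁻¹
  infix  4 _≤_
  field
    ℝ                 : Set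
    _+_ _*_           : ℝ → ℝ → ℝ
    -_ _⁻¹            : ℝ → ℝ
    0# 1#             : ℝ
    _≤_               : Rel ℝ 0ℓ
    isCommutativeRing : IsCommutativeRing _≡_ _+_ _*_ -_ 0# 1#
    0≢1               : 0# ≢ 1#
    *-inverseʳ        : ∀ x → x ≢ 0# → x * x ⁻¹ ≡ 1#
    isDecTotalOrder   : IsDecTotalOrder _≡_ _≤_
    +-monoʳ-≤         : ∀ x {y z} → y ≤ z → x + y ≤ x + z
    *-nonNeg          : ∀ {x y} → 0# ≤ x → 0# ≤ y → 0# ≤ x * y
    complete          : (S : Pred ℝ 0ℓ) → ∃[ x ] x ∈ S →
                        ∃[ b ] (∀ x → x ∈ S → x ≤ b) →
                        ∃[ s ] IsSupremum _≤_ S s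

  commutativeRing : CommutativeRing 0ℓ 0ℓ
  commutativeRing = record { isCommutativeRing = isCommutativeRing }

  open IsDecTotalOrder isDecTotalOrder public using (_≟_; _≤?_)
  open Strict _≡_ _≤_ public using (_<_)

  _-_ _/_ : ℝ → ℝ → ℝ
  x - y = x + (- y)
  x / y = x * y ⁻¹

  fromℕ : ℕ → ℝ
  fromℕ k = k ×ᵐ 1#
    where open Mult (CommutativeRing.+-monoid commutativeRing) renaming (_×_ to _×ᵐ_)

module PropertyTesting (R : RealNumbers) where
  open RealNumbers R public

  open Sum (CommutativeRing.+-commutativeMonoid commutativeRing) public
    using (sum; sum-syntax)
  open Sum (CommutativeRing.*-commutativeMonoid commutativeRing) public
    using () renaming (sum to product)

  -- The domain [n]^d.  Coordinates run over 0,…,n-1 instead of 1,…,n.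
  Point : ℕ → ℕ → Set
  Point n d = Vec (Fin n) d

  Function : ℕ → ℕ → Set → Set
  Function n d A = Point n d → A

  Property : ℕ → ℕ → Set → Set₁
  Property n d A = Pred (Function n d A) 0ℓ

  record Distribution (n : ℕ) : Set where
    field
      weight   : Fin n → ℝ
      nonNeg   : ∀ i → 0# ≤ weight i
      sum≡1    : sum weight ≡ 1#

  ProductDistribution : ℕ → ℕ → Set
  ProductDistribution n d = Fin d → Distribution n

  sumPoints : ∀ {n} d → (Point n d → ℝ) → ℝ
  sumPoints zero    h = h []
  sumPoints {n} (suc d) h = ∑[ i < n ] sumPoints d (λ x → h (i ∷ x))

  mass : ∀ {n d} → ProductDistribution n d → Point n d → ℝ
  mass D x = product (λ r → Distribution.weight (D r) (lookup x r))

  Pr : ∀ {n d} → ProductDistribution n d →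
       {E : Pred (Point n d) 0ℓ} → Decidable E → ℝ
  Pr {d = d} D E? = sumPoints d (λ x → if does (E? x) then mass D x else 0#)

  -- Here n = suc m, so that [n-1] is Fin m; for i : Fin m the elements i and
  -- i + 1 of [n] are inject₁ i and Fin.suc i.
  record BoundingFamily (m d : ℕ) : Set where
    field
      l u : Fin d → Fin m → ℝ
      l<u : ∀ r y → l r y < u r y

  𝒫 : ∀ {m d} → BoundingFamily m d → Property (suc m) d ℝ
  𝒫 B f = ∀ r x i → lookup x r ≡ inject₁ i →
    let ∂f = f (x [ r ]≔ Fin.suc i) - f x in l r i ≤ ∂f × ∂f ≤ u r i
    where open BoundingFamily B

  Monotone : ∀ {n d} → Property n d ℕ
  Monotone f = ∀ x y → (∀ r → lookup x r Fin.≤ lookup y r) → f x ℕ.≤ f y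

  -- inf_{g ∈ P} Pr_{x ∼ D} [ f x ≠ g x ] > ε
  Far : ∀ {n d} {A : Set} → DecidableEquality A → ProductDistribution n d →
        Property n d A → ℝ → Function n d A → Set
  Far _≟ᴬ_ D P ε f =
    ∃[ δ ] IsInfimum _≤_ (λ p → ∃[ g ] g ∈ P × p ≡ Pr D (λ x → ¬? (f x ≟ᴬ g x))) δ
           × ε < δ

  -- The laws constrain μ on measurable events only; its values elsewhere are
  -- irrelevant.
  record ProbabilitySpace : Set₁ where
    field
      Ω            : Set
      Measurable   : Pred (Pred Ω 0ℓ) 0ℓ
      μ            : Pred Ω 0ℓ → ℝ
      measurable-≐ : ∀ {E F} → E ≐ F → Measurable E → Measurable F
      measurable-U : Measurable U
      measurable-∁ : ∀ {E} → Measurable E → Measurable (∁ E)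
      measurable-⋃ : ∀ (E : ℕ → Pred Ω 0ℓ) → (∀ k → Measurable (E k)) →
                     Measurable (⋃ ℕ E)
      μ-≐          : ∀ {E F} → E ≐ F → Measurable E → μ E ≡ μ F
      μ-nonNeg     : ∀ {E} → Measurable E → 0# ≤ μ E
      μ-U          : μ U ≡ 1#
      -- For nonnegative terms the sum of a series is the supremum of its
      -- partial sums.
      μ-⋃          : ∀ (E : ℕ → Pred Ω 0ℓ) → (∀ k → Measurable (E k)) →
                     (∀ j k → j ≢ k → E j ⊥ E k) →
                     IsSupremum _≤_ (λ s → ∃[ k ] s ≡ ∑[ j < k ] μ (E (toℕ j)))
                                    (μ (⋃ ℕ E))

  -- The output true means accept.
  data DecisionTree (n d : ℕ) (A : Set) : Set where
    output : Bool → DecisionTree n d A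
    query  : Point n d → (A → DecisionTree n d A) → DecisionTree n d A

  run : ∀ {n d A} → DecisionTree n d A → Function n d A → Bool
  run (output b)  f = b
  run (query x k) f = run (k (f x)) f

  #queries : ∀ {n d A} → DecisionTree n d A → Function n d A → ℕ
  #queries (output b)  f = 0
  #queries (query x k) f = suc (#queries (k (f x)) f)

  -- A q-query tester for P with respect to D with proximity parameter ε: a
  -- randomised algorithm is a decision tree depending on a random seed ω.
  record Tester {n d : ℕ} {A : Set} (_≟ᴬ_ : DecidableEquality A)
                (D : ProductDistribution n d) (P : Property n d A)
                (ε q : ℝ) : Set₁ where
    field
      space      : ProbabilitySpace
    open ProbabilitySpace space public
    field
      tree       : Ω → DecisionTree n d A
      measurable : ∀ f b → Measurable (λ ω → run (tree ω) f ≡ b)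
      bounded    : ∀ f ω → fromℕ (#queries (tree ω) f) ≤ q
      accepts    : ∀ f → f ∈ P →
                   fromℕ 2 / fromℕ 3 < μ (λ ω → run (tree ω) f ≡ true)
      rejects    : ∀ f → Far _≟ᴬ_ D P ε f →
                   fromℕ 2 / fromℕ 3 < μ (λ ω → run (tree ω) f ≡ false)

{-# OPTIONS --safe #-}
module Submission where

open import Defs
open import Algebra.Bundles using (CommutativeRing)
open import Data.Bool.Base using (Bool; true; false; if_then_else_; _∨_)
import Data.Bool.Properties as Bool
open import Data.Empty using (⊥-elim)
open import Data.Fin.Base as Fin using (Fin; zero; suc; toℕ; inject₁)
open import Data.Fin.Properties using (toℕ-inject₁; ≤fromℕ)
open import Data.Nat.Base as ℕ using (ℕ; zero; suc; z≤n; s≤s)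
import Data.Nat.Properties as ℕ
open import Data.Nat.Properties using () renaming (_≟_ to _≟ℕ_)
open import Data.Product.Base using (_×_; _,_; proj₁; proj₂; ∃-syntax; uncurry)
open import Data.Sum.Base using (_⊎_; inj₁; inj₂)
open import Data.Vec.Base as Vec using (Vec; []; _∷_; lookup; replicate; _[_]≔_)
open import Data.Vec.Membership.Propositional using (_∈_; lose)
open import Data.Vec.Membership.Propositional.Properties using (∈-map⁺; ∈-allPairs⁺; ∈-allFin⁺)
open import Data.Vec.Properties using (lookup-replicate)
open import Data.Vec.Relation.Unary.Any using (here; any?; satisfied)
open import Function.Base using (_∘_)
open import Level using (0ℓ)
open import Relation.Binary.PropositionalEquality
  using (_≡_; _≢_; refl; sym; trans; cong; cong₂; subst)
open import Relation.Nullary.Decidable using (Dec; yes; no; does; ¬?; dec-false)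
open import Relation.Nullary.Negation using (¬_)
open import Relation.Unary using (Pred; Decidable; _≐_)
import Algebra.Properties.Semiring.Mult as SemiringMult
import Algebra.Properties.Semiring.Sum as SemiringSum
import Algebra.Properties.Ring as RingProperties
import Algebra.Solver.Ring.NaturalCoefficients.Default as SemiringSolver
import Relation.Binary.Bundles as Bundles
import Relation.Binary.Properties.DecTotalOrder as DecTotalOrderProperties
import Relation.Binary.Reasoning.PartialOrder as PosetReasoning

-- Let L be the function whose derivatives are the lower bounds l, and let t be
-- the top point of the grid.  For a small δ > 0 the function L + δ f lies in
-- 𝒫 B when f is monotone with values at most M; conversely, if h ∈ 𝒫 B, then
-- h - L is monotone, and rounding (h - L) / δ down to at most M recovers f wherever h
-- agrees with L + δ f and f ≤ M.
-- A monotone f is bounded by M = f t, so the tester queries t, samples k points,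
-- rejects if one of them has a value above M, and otherwise simulates the given
-- tester on L + δ f.  If f is 2ε-far from monotone, then either Pr[f > M] > ε and
-- the sample alone rejects with probability more than 2/3, or Pr[f > M] ≤ ε and
-- L + δ f is ε-far from 𝒫 B.  Only one of the two sources of error matters in
-- each case, so the threshold 2/3 is not weakened by a union bound.

-- Arithmetic in an ordered field, up to Bernoulli's inequality.

module OrderedField (R : RealNumbers) where
  open RealNumbers R
  open CommutativeRing commutativeRing public
    using ( +-assoc; +-comm; +-identityˡ; +-identityʳ; *-assoc; *-comm
          ; *-identityˡ; *-identityʳ; distribˡ; distribʳ; zeroˡ; zeroʳ; semiring; commutativeSemiring; ring)

  decTotalOrder : Bundles.DecTotalOrder 0ℓ 0ℓ 0ℓ
  decTotalOrder = record { isDecTotalOrder = isDecTotalOrder }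

  open Bundles.DecTotalOrder decTotalOrder public
    using () renaming (refl to ≤-refl; reflexive to ≤-reflexive; trans to ≤-trans;
                       antisym to ≤-antisym; total to ≤-total)
  open DecTotalOrderProperties decTotalOrder public using (≰⇒>; ≰⇒≥; <⇒≱)
  module ≤-Reasoning = PosetReasoning (Bundles.DecTotalOrder.poset decTotalOrder)
  open ≤-Reasoning
  open RingProperties ring public using (-1*x≈-x; -‿involutive)
    renaming (//-rightDividesˡ to y-x+x≡y; //-rightDividesʳ to y+x-x≡y)
  open SemiringSolver commutativeSemiring public using (solve; _:=_; _:+_; _:*_; con)

  <-≤-trans : ∀ {x y z} → x < y → y ≤ z → x < z
  <-≤-trans {x} {y} {z} x<y y≤z = begin-strict x <⟨ x<y ⟩ y ≤⟨ y≤z ⟩ z ∎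

  +-monoˡ-≤ : ∀ z {x y} → x ≤ y → x + z ≤ y + z
  +-monoˡ-≤ z {x} {y} x≤y = begin
    x + z ≡⟨ +-comm x z ⟩
    z + x ≤⟨ +-monoʳ-≤ z x≤y ⟩
    z + y ≡⟨ +-comm z y ⟩
    y + z ∎

  +-mono-≤ : ∀ {x y u v} → x ≤ y → u ≤ v → x + u ≤ y + v
  +-mono-≤ {y = y} {u} x≤y u≤v = ≤-trans (+-monoˡ-≤ u x≤y) (+-monoʳ-≤ y u≤v)

  x+z≤y⇒x≤y-z : ∀ {x y z} → x + z ≤ y → x ≤ y - z
  x+z≤y⇒x≤y-z {x} {y} {z} x+z≤y = begin
    x         ≡⟨ y+x-x≡y z x ⟨
    x + z - z ≤⟨ +-monoˡ-≤ (- z) x+z≤y ⟩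
    y - z     ∎

  x≤y-z⇒x+z≤y : ∀ {x y z} → x ≤ y - z → x + z ≤ y
  x≤y-z⇒x+z≤y {x} {y} {z} x≤y-z = begin
    x + z     ≤⟨ +-monoˡ-≤ z x≤y-z ⟩
    y - z + z ≡⟨ y-x+x≡y z y ⟩
    y         ∎

  x≤y+z⇒x-z≤y : ∀ {x y z} → x ≤ y + z → x - z ≤ y
  x≤y+z⇒x-z≤y {x} {y} {z} x≤y+z = begin
    x - z     ≤⟨ +-monoˡ-≤ (- z) x≤y+z ⟩
    y + z - z ≡⟨ y+x-x≡y z y ⟩
    y         ∎

  +-cancelʳ-≤ : ∀ z {x y} → x + z ≤ y + z → x ≤ y
  +-cancelʳ-≤ z {x} {y} x+z≤y+z = begin
    x         ≤⟨ x+z≤y⇒x≤y-z x+z≤y+z ⟩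
    y + z - z ≡⟨ y+x-x≡y z y ⟩
    y         ∎

  +-cancelˡ-≤ : ∀ z {x y} → z + x ≤ z + y → x ≤ y
  +-cancelˡ-≤ z {x} {y} z+x≤z+y = +-cancelʳ-≤ z (begin
    x + z ≡⟨ +-comm x z ⟩
    z + x ≤⟨ z+x≤z+y ⟩
    z + y ≡⟨ +-comm z y ⟩
    y + z ∎)

  x≤x+y : ∀ x {y} → 0# ≤ y → x ≤ x + y
  x≤x+y x {y} 0≤y = begin
    x      ≡⟨ +-identityʳ x ⟨
    x + 0# ≤⟨ +-monoʳ-≤ x 0≤y ⟩
    x + y  ∎

  x≤y⇒0≤y-x : ∀ {x y} → x ≤ y → 0# ≤ y - x
  x≤y⇒0≤y-x {x} {y} x≤y = x+z≤y⇒x≤y-z (≤-trans (≤-reflexive (+-identityˡ x)) x≤y)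

  x<y⇒0<y-x : ∀ {x y} → x < y → 0# < y - x
  x<y⇒0<y-x {x} {y} (x≤y , x≢y) = x≤y⇒0≤y-x x≤y , λ 0≡y-x → x≢y (begin-equality
    x         ≡⟨ +-identityˡ x ⟨
    0# + x    ≡⟨ cong (_+ x) 0≡y-x ⟩
    y - x + x ≡⟨ y-x+x≡y x y ⟩
    y         ∎)

  *-monoˡ-≤ : ∀ {z x y} → 0# ≤ z → x ≤ y → z * x ≤ z * y
  *-monoˡ-≤ {z} {x} {y} 0≤z x≤y = begin
    z * x               ≤⟨ x≤x+y (z * x) (*-nonNeg 0≤z (x≤y⇒0≤y-x x≤y)) ⟩
    z * x + z * (y - x) ≡⟨ distribˡ z x (y - x) ⟨
    z * (x + (y - x))   ≡⟨ cong (z *_) (trans (+-comm x (y - x)) (y-x+x≡y x y)) ⟩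
    z * y               ∎

  *-monoʳ-≤ : ∀ {z x y} → 0# ≤ z → x ≤ y → x * z ≤ y * z
  *-monoʳ-≤ {z} {x} {y} 0≤z x≤y = begin
    x * z ≡⟨ *-comm x z ⟩
    z * x ≤⟨ *-monoˡ-≤ 0≤z x≤y ⟩
    z * y ≡⟨ *-comm z y ⟩
    y * z ∎

  0≤1 : 0# ≤ 1#
  0≤1 with ≤-total 0# 1#
  ... | inj₁ 0≤1 = 0≤1
  ... | inj₂ 1≤0 = begin
    0#          ≤⟨ *-nonNeg 0≤-1 0≤-1 ⟩
    - 1# * - 1# ≡⟨ -1*x≈-x (- 1#) ⟩
    - (- 1#)    ≡⟨ -‿involutive 1# ⟩
    1#          ∎
    where
    0≤-1 : 0# ≤ - 1#
    0≤-1 = ≤-trans (x≤y⇒0≤y-x 1≤0) (≤-reflexive (+-identityˡ (- 1#)))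

  0<1 : 0# < 1#
  0<1 = 0≤1 , 0≢1

  *-inverseˡ : ∀ x → x ≢ 0# → x ⁻¹ * x ≡ 1#
  *-inverseˡ x x≢0 = trans (*-comm (x ⁻¹) x) (*-inverseʳ x x≢0)

  >⇒≢ : ∀ {x} → 0# < x → x ≢ 0#
  >⇒≢ (_ , 0≢x) x≡0 = 0≢x (sym x≡0)

  ⁻¹-nonNeg : ∀ {x} → 0# < x → 0# ≤ x ⁻¹
  ⁻¹-nonNeg {x} 0<x with ≤-total 0# (x ⁻¹)
  ... | inj₁ 0≤x⁻¹ = 0≤x⁻¹
  ... | inj₂ x⁻¹≤0 = ⊥-elim (<⇒≱ 0<1 (begin
    1#       ≡⟨ *-inverseʳ x (>⇒≢ 0<x) ⟨
    x * x ⁻¹ ≤⟨ *-monoˡ-≤ (proj₁ 0<x) x⁻¹≤0 ⟩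
    x * 0#   ≡⟨ zeroʳ x ⟩
    0#       ∎))

  x/y*y≡x : ∀ x {y} → 0# < y → x / y * y ≡ x
  x/y*y≡x x {y} 0<y = begin-equality
    x * y ⁻¹ * y   ≡⟨ *-assoc x (y ⁻¹) y ⟩
    x * (y ⁻¹ * y) ≡⟨ cong (x *_) (*-inverseˡ y (>⇒≢ 0<y)) ⟩
    x * 1#         ≡⟨ *-identityʳ x ⟩
    x              ∎

  x*y≤z⇒x≤z/y : ∀ {x y z} → 0# < y → x * y ≤ z → x ≤ z / y
  x*y≤z⇒x≤z/y {x} {y} {z} 0<y x*y≤z = begin
    x              ≡⟨ *-identityʳ x ⟨
    x * 1#         ≡⟨ cong (x *_) (*-inverseʳ y (>⇒≢ 0<y)) ⟨
    x * (y * y ⁻¹) ≡⟨ *-assoc x y (y ⁻¹) ⟨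
    x * y * y ⁻¹   ≤⟨ *-monoʳ-≤ (⁻¹-nonNeg 0<y) x*y≤z ⟩
    z / y          ∎

  x≤z/y⇒x*y≤z : ∀ {x y z} → 0# < y → x ≤ z / y → x * y ≤ z
  x≤z/y⇒x*y≤z {x} {y} {z} 0<y x≤z/y =
    ≤-trans (*-monoʳ-≤ (proj₁ 0<y) x≤z/y) (≤-reflexive (x/y*y≡x z 0<y))

  *-cancelʳ-≤ : ∀ {x y z} → 0# < z → x * z ≤ y * z → x ≤ y
  *-cancelʳ-≤ {x} {y} {z} 0<z xz≤yz = begin
    x               ≤⟨ x*y≤z⇒x≤z/y 0<z xz≤yz ⟩
    y * z * z ⁻¹    ≡⟨ *-assoc y z (z ⁻¹) ⟩
    y * (z * z ⁻¹)  ≡⟨ cong (y *_) (*-inverseʳ z (>⇒≢ 0<z)) ⟩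
    y * 1#          ≡⟨ *-identityʳ y ⟩
    y               ∎

  *-cancelˡ-≤ : ∀ {x y z} → 0# < z → z * x ≤ z * y → x ≤ y
  *-cancelˡ-≤ {x} {y} {z} 0<z zx≤zy = *-cancelʳ-≤ 0<z (begin
    x * z ≡⟨ *-comm x z ⟩
    z * x ≤⟨ zx≤zy ⟩
    z * y ≡⟨ *-comm z y ⟩
    y * z ∎)

  /-pos : ∀ {x y} → 0# < x → 0# < y → 0# < x / y
  /-pos {x} {y} 0<x 0<y =
    *-nonNeg (proj₁ 0<x) (⁻¹-nonNeg 0<y) , λ 0≡x/y → proj₂ 0<x (begin-equality
      0#        ≡⟨ zeroˡ y ⟨
      0# * y    ≡⟨ cong (_* y) 0≡x/y ⟩
      x / y * y ≡⟨ x/y*y≡x x 0<y ⟩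
      x         ∎)

  open SemiringMult semiring using (×-homo-+)

  fromℕ-+ : ∀ j k → fromℕ (j ℕ.+ k) ≡ fromℕ j + fromℕ k
  fromℕ-+ = ×-homo-+ 1#

  fromℕ-nonNeg : ∀ k → 0# ≤ fromℕ k
  fromℕ-nonNeg zero    = ≤-refl
  fromℕ-nonNeg (suc k) = ≤-trans 0≤1 (x≤x+y 1# (fromℕ-nonNeg k))

  fromℕ-mono-≤ : ∀ {j k} → j ℕ.≤ k → fromℕ j ≤ fromℕ k
  fromℕ-mono-≤ {k = k} z≤n = fromℕ-nonNeg k
  fromℕ-mono-≤ (s≤s j≤k)   = +-monoʳ-≤ 1# (fromℕ-mono-≤ j≤k)

  fromℕ-pos : ∀ k → 0# < fromℕ (suc k)
  fromℕ-pos k = <-≤-trans 0<1 (x≤x+y 1# (fromℕ-nonNeg k))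

  fromℕ-cancel-≤ : ∀ {j k} → fromℕ j ≤ fromℕ k → j ℕ.≤ k
  fromℕ-cancel-≤ {zero}          _     = z≤n
  fromℕ-cancel-≤ {suc j} {zero}  1+j≤0 = ⊥-elim (<⇒≱ (fromℕ-pos j) 1+j≤0)
  fromℕ-cancel-≤ {suc j} {suc k} j≤k   = s≤s (fromℕ-cancel-≤ (+-cancelˡ-≤ 1# j≤k))

  2/3<1 : fromℕ 2 / fromℕ 3 < 1#
  2/3<1 = ≰⇒> λ 1≤2/3 → ℕ.<⇒≱ (ℕ.n<1+n 2) (fromℕ-cancel-≤ (begin
    fromℕ 3      ≡⟨ *-identityˡ (fromℕ 3) ⟨
    1# * fromℕ 3 ≤⟨ x≤z/y⇒x*y≤z (fromℕ-pos 2) 1≤2/3 ⟩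
    fromℕ 2      ∎))

  -- A total floor would need the Archimedean property with an explicit bound,
  -- which completeness does not provide constructively; so the search is cut off at N.
  boundedFloor : ∀ N x → fromℕ 1 ≤ x → fromℕ (suc N) ≤ x ⊎
                 ∃[ k ] fromℕ (suc k) ≤ x × x ≤ fromℕ (2 ℕ.+ k)
  boundedFloor zero    x 1≤x = inj₁ 1≤x
  boundedFloor (suc N) x 1≤x with boundedFloor N x 1≤x
  ... | inj₂ found = inj₂ found
  ... | inj₁ 1+N≤x with fromℕ (2 ℕ.+ N) ≤? x
  ...   | yes 2+N≤x = inj₁ 2+N≤x
  ...   | no  2+N≰x = inj₂ (N , 1+N≤x , ≰⇒≥ 2+N≰x)

  infixr 8 _^_

  _^_ : ℝ → ℕ → ℝ
  x ^ zero  = 1#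
  x ^ suc k = x * x ^ k

  ^-nonNeg : ∀ {x} k → 0# ≤ x → 0# ≤ x ^ k
  ^-nonNeg zero    0≤x = 0≤1
  ^-nonNeg (suc k) 0≤x = *-nonNeg 0≤x (^-nonNeg k 0≤x)

  -- Since `q` is `1 - p`, multiplying `1 + (k + 1) p` by `q` gives `1 + k p - (k + 1) p²`, so each
  -- induction step can only decrease the product; the first inequality adds the missing square
  -- term. Writing `q + p ≡ 1#` instead of a subtraction keeps the identities within reach of a
  -- semiring solver.
  bernoulli : ∀ {p q} k → 0# ≤ p → 0# ≤ q → q + p ≡ 1# → q ^ k * (1# + fromℕ k * p) ≤ 1#
  bernoulli {p} {q} zero 0≤p 0≤q q+p≡1 =
    ≤-reflexive (solve 1 (λ p → con 1 :* (con 1 :+ con 0 :* p) := con 1) refl p)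
  bernoulli {p} {q} (suc k) 0≤p 0≤q q+p≡1 = begin
    q * q ^ k * (1# + (1# + c) * p)            ≤⟨ x≤x+y _ (*-nonNeg (^-nonNeg k 0≤q)
                                                    (*-nonNeg (fromℕ-nonNeg (suc k)) (*-nonNeg 0≤p 0≤p))) ⟩
    q * q ^ k * (1# + (1# + c) * p) + q ^ k * ((1# + c) * (p * p))
      ≡⟨ solve 4 (λ p q y c → q :* y :* (con 1 :+ (con 1 :+ c) :* p)
                              :+ y :* ((con 1 :+ c) :* (p :* p))
                         := y :* (q :+ (q :+ p) :* ((con 1 :+ c) :* p))) refl p q (q ^ k) c ⟩
    q ^ k * (q + (q + p) * ((1# + c) * p))     ≡⟨ cong (λ s → q ^ k * (q + s * ((1# + c) * p))) q+p≡1 ⟩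
    q ^ k * (q + 1# * ((1# + c) * p))
      ≡⟨ solve 4 (λ p q y c → y :* (q :+ con 1 :* ((con 1 :+ c) :* p))
                         := y :* ((q :+ p) :+ c :* p)) refl p q (q ^ k) c ⟩
    q ^ k * ((q + p) + c * p)                  ≡⟨ cong (λ s → q ^ k * (s + c * p)) q+p≡1 ⟩
    q ^ k * (1# + c * p)                       ≤⟨ bernoulli k 0≤p 0≤q q+p≡1 ⟩
    1#                                         ∎
    where
    c = fromℕ k

-- Expectations as monotone linear functionals.

module Expectations (R : RealNumbers) where
  open PropertyTesting R
  open OrderedField R
  open ≤-Reasoning
  open SemiringSum semiring using (*-distribˡ-sum; ∑-distrib-+; sum-cong-≗)

  -- This is the half of being a supremum that has to be carried through integration; the other
  -- half, that `s` is an upper bound, passes through `𝔼-mono` directly.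
  LeastBound : (ℕ → ℝ) → ℝ → Set
  LeastBound a s = ∀ b → (∀ k → a k ≤ b) → s ≤ b

  -- The exchange with suprema of monotone sequences is what makes products
  -- with a probability space countably additive.
  record Expectation (S : Set) : Set₁ where
    field
      𝔼      : (S → ℝ) → ℝ
      𝔼-mono : ∀ {f g} → (∀ s → f s ≤ g s) → 𝔼 f ≤ 𝔼 g
      𝔼-+    : ∀ f g → 𝔼 (λ s → f s + g s) ≡ 𝔼 f + 𝔼 g
      𝔼-*    : ∀ c f → 𝔼 (λ s → c * f s) ≡ c * 𝔼 f
      𝔼-1    : 𝔼 (λ _ → 1#) ≡ 1#
      𝔼-sup  : ∀ {F : ℕ → S → ℝ} {f} → (∀ {j k} → j ℕ.≤ k → ∀ s → F j s ≤ F k s) →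
               (∀ s → LeastBound (λ k → F k s) (f s)) → LeastBound (λ k → 𝔼 (F k)) (𝔼 f)

    𝔼-cong : ∀ {f g} → (∀ s → f s ≡ g s) → 𝔼 f ≡ 𝔼 g
    𝔼-cong f≗g = ≤-antisym (𝔼-mono (≤-reflexive ∘ f≗g)) (𝔼-mono (≤-reflexive ∘ sym ∘ f≗g))

    𝔼-const : ∀ c → 𝔼 (λ _ → c) ≡ c
    𝔼-const c = begin-equality
      𝔼 (λ _ → c)      ≡⟨ 𝔼-cong (λ _ → sym (*-identityʳ c)) ⟩
      𝔼 (λ _ → c * 1#) ≡⟨ 𝔼-* c (λ _ → 1#) ⟩
      c * 𝔼 (λ _ → 1#) ≡⟨ cong (c *_) 𝔼-1 ⟩
      c * 1#           ≡⟨ *-identityʳ c ⟩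
      c                ∎

    𝔼-≥ : ∀ {c f} → (∀ s → c ≤ f s) → c ≤ 𝔼 f
    𝔼-≥ {c} c≤f = ≤-trans (≤-reflexive (sym (𝔼-const c))) (𝔼-mono c≤f)

    𝔼-≤ : ∀ {c f} → (∀ s → f s ≤ c) → 𝔼 f ≤ c
    𝔼-≤ {c} f≤c = ≤-trans (𝔼-mono f≤c) (≤-reflexive (𝔼-const c))

    𝔼-sum : ∀ {n} (f : Fin n → S → ℝ) →
            𝔼 (λ s → ∑[ i < n ] f i s) ≡ ∑[ i < n ] 𝔼 (f i)
    𝔼-sum {zero}  f = 𝔼-const 0#
    𝔼-sum {suc n} f = trans (𝔼-+ (f zero) _) (cong (𝔼 (f zero) +_) (𝔼-sum (f ∘ suc)))

  open Expectation

  dirac : ∀ {S} → S → Expectation S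
  dirac s = record
    { 𝔼      = λ f → f s
    ; 𝔼-mono = λ f≤g → f≤g s
    ; 𝔼-+    = λ _ _ → refl
    ; 𝔼-*    = λ _ _ → refl
    ; 𝔼-1    = refl
    ; 𝔼-sup  = λ _ sup → sup s
    }

  infixl 1 _>>=_

  -- Iterated integration: with `dirac` as unit this is the bind of a monad, so product
  -- distributions and independent samples arise by sequencing. The exchange with suprema composes
  -- because the inner expectations again form a monotone sequence.
  _>>=_ : ∀ {S T} → Expectation S → (S → Expectation T) → Expectation T
  e >>= k = record
    { 𝔼      = λ f → 𝔼 e (λ s → 𝔼 (k s) f)
    ; 𝔼-mono = λ f≤g → 𝔼-mono e (λ s → 𝔼-mono (k s) f≤g)
    ; 𝔼-+    = λ f g → trans (𝔼-cong e (λ s → 𝔼-+ (k s) f g)) (𝔼-+ e _ _)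
    ; 𝔼-*    = λ c f → trans (𝔼-cong e (λ s → 𝔼-* (k s) c f)) (𝔼-* e c _)
    ; 𝔼-1    = trans (𝔼-cong e (λ s → 𝔼-1 (k s))) (𝔼-1 e)
    ; 𝔼-sup  = λ mono sup → 𝔼-sup e (λ j≤k s → 𝔼-mono (k s) (mono j≤k))
                                     (λ s → 𝔼-sup (k s) mono sup)
    }

  -- The two suprema are taken one after the other, which requires `a j + b k ≤ c` for independent
  -- indices. Monotonicity moves both indices up to `j ⊔ k`, where the hypothesis on the sum
  -- applies.
  LeastBound-+ : ∀ {a b : ℕ → ℝ} {x y} →
                 (∀ {j k} → j ℕ.≤ k → a j ≤ a k) → (∀ {j k} → j ℕ.≤ k → b j ≤ b k) →
                 LeastBound a x → LeastBound b y → LeastBound (λ k → a k + b k) (x + y)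
  LeastBound-+ {a} {b} {x} {y} a-mono b-mono x-least y-least c a+b≤c =
    x≤y-z⇒x+z≤y (x-least (c - y) λ j → x+z≤y⇒x≤y-z (
      ≤-trans (≤-reflexive (+-comm (a j) y)) (x≤y-z⇒x+z≤y (y-least (c - a j) λ k →
        x+z≤y⇒x≤y-z (begin
          b k + a j                     ≤⟨ +-mono-≤ (b-mono (ℕ.m≤n⊔m j k)) (a-mono (ℕ.m≤m⊔n j k)) ⟩
          b (j ℕ.⊔ k) + a (j ℕ.⊔ k)     ≡⟨ +-comm _ _ ⟩
          a (j ℕ.⊔ k) + b (j ℕ.⊔ k)     ≤⟨ a+b≤c (j ℕ.⊔ k) ⟩
          c                             ∎)))))

  LeastBound-* : ∀ {a : ℕ → ℝ} {x w} → 0# ≤ w → LeastBound a x → LeastBound (λ k → w * a k) (w * x)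
  LeastBound-* {a} {x} {w} 0≤w least c wa≤c with 0# ≟ w
  -- Division by the weight is impossible here. What remains is `0# ≤ c`, and any single index, such
  -- as 0, yields it.
  ... | yes refl = begin
    0# * x     ≡⟨ zeroˡ x ⟩
    0#         ≡⟨ zeroˡ (a 0) ⟨
    0# * a 0   ≤⟨ wa≤c 0 ⟩
    c          ∎
  ... | no 0≢w = begin
    w * x ≡⟨ *-comm w x ⟩
    x * w ≤⟨ x≤z/y⇒x*y≤z 0<w (least (c / w) λ k →
               x*y≤z⇒x≤z/y 0<w (≤-trans (≤-reflexive (*-comm (a k) w)) (wa≤c k))) ⟩
    c     ∎
    where
    0<w : 0# < w
    0<w = 0≤w , 0≢w

  sum-mono : ∀ {n} {f g : Fin n → ℝ} → (∀ i → f i ≤ g i) → sum f ≤ sum g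
  sum-mono {zero}  f≤g = ≤-refl
  sum-mono {suc n} f≤g = +-mono-≤ (f≤g zero) (sum-mono (f≤g ∘ suc))

  LeastBound-sum : ∀ {n} {a : ℕ → Fin n → ℝ} {x : Fin n → ℝ} →
                   (∀ {j k} → j ℕ.≤ k → ∀ i → a j i ≤ a k i) →
                   (∀ i → LeastBound (λ k → a k i) (x i)) →
                   LeastBound (λ k → sum (a k)) (sum x)
  LeastBound-sum {zero}  mono least c 0≤c = 0≤c 0
  LeastBound-sum {suc n} mono least =
    LeastBound-+ (λ j≤k → mono j≤k zero) (λ j≤k → sum-mono (mono j≤k ∘ suc))
      (least zero) (LeastBound-sum (λ j≤k → mono j≤k ∘ suc) (least ∘ suc))

  fromDistribution : ∀ {n} → Distribution n → Expectation (Fin n)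
  fromDistribution {n} D = record
    { 𝔼      = λ f → sum (λ i → weight i * f i)
    ; 𝔼-mono = λ f≤g → sum-mono (λ i → *-monoˡ-≤ (nonNeg i) (f≤g i))
    ; 𝔼-+    = λ f g → trans (sum-cong-≗ (λ i → distribˡ (weight i) (f i) (g i)))
                           (∑-distrib-+ {n} _ _)
    ; 𝔼-*    = λ c f → trans
        (sum-cong-≗ (λ i → solve 3 (λ w c x → w :* (c :* x) := c :* (w :* x)) refl (weight i) c (f i)))
        (sym (*-distribˡ-sum {n} c _))
    ; 𝔼-1    = trans (sum-cong-≗ (λ i → *-identityʳ (weight i))) sum≡1
    ; 𝔼-sup  = λ mono least → LeastBound-sum (λ j≤k i → *-monoˡ-≤ (nonNeg i) (mono j≤k i))
                                             (λ i → LeastBound-* (nonNeg i) (least i))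
    }
    where open Distribution D

  point : ∀ {n} d → ProductDistribution n d → Expectation (Point n d)
  point zero    D = dirac []
  point (suc d) D = fromDistribution (D zero) >>= λ i → point d (D ∘ suc) >>= λ x → dirac (i ∷ x)

  samples : ∀ {S} k → Expectation S → Expectation (Vec S k)
  samples zero    e = dirac []
  samples (suc k) e = e >>= λ s → samples k e >>= λ ss → dirac (s ∷ ss)

  -- Probabilities as expectations of indicators.

  indicator : Bool → ℝ
  indicator b = if b then 1# else 0#

  𝟙 : ∀ {E : Set} → Dec E → ℝ
  𝟙 E? = indicator (does E?)

  sumPoints-cong : ∀ {n} d {g h : Point n d → ℝ} → (∀ x → g x ≡ h x) →
                   sumPoints d g ≡ sumPoints d h
  sumPoints-cong zero    g≗h = g≗h []
  sumPoints-cong (suc d) g≗h = sum-cong-≗ (λ i → sumPoints-cong d (λ x → g≗h (i ∷ x)))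

  *-distribˡ-sumPoints : ∀ {n} d c (h : Point n d → ℝ) →
                         c * sumPoints d h ≡ sumPoints d (λ x → c * h x)
  *-distribˡ-sumPoints zero        c h = refl
  *-distribˡ-sumPoints {n} (suc d) c h = trans
    (*-distribˡ-sum {n} c _)
    (sum-cong-≗ (λ i → *-distribˡ-sumPoints d c (λ x → h (i ∷ x))))

  -- The mass of a point factors over its coordinates, so the factor of the first coordinate can be
  -- pulled out of the sum over the others; repeating this turns the weighted sum into an iterated
  -- expectation.
  sumPoints-mass : ∀ {n} d (D : ProductDistribution n d) (h : Point n d → ℝ) →
                   sumPoints d (λ x → mass D x * h x) ≡ 𝔼 (point d D) h
  sumPoints-mass zero    D h = *-identityˡ (h [])
  sumPoints-mass {n} (suc d) D h = sum-cong-≗ λ i → begin-equality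
    sumPoints d (λ x → weight i * mass (D ∘ suc) x * h (i ∷ x))
      ≡⟨ sumPoints-cong d (λ x → *-assoc (weight i) (mass (D ∘ suc) x) (h (i ∷ x))) ⟩
    sumPoints d (λ x → weight i * (mass (D ∘ suc) x * h (i ∷ x)))
      ≡⟨ *-distribˡ-sumPoints d (weight i) _ ⟨
    weight i * sumPoints d (λ x → mass (D ∘ suc) x * h (i ∷ x))
      ≡⟨ cong (weight i *_) (sumPoints-mass d (D ∘ suc) (λ x → h (i ∷ x))) ⟩
    weight i * 𝔼 (point d (D ∘ suc)) (λ x → h (i ∷ x)) ∎
    where open Distribution (D zero)

  Pr≡𝔼 : ∀ {n d} (D : ProductDistribution n d) {E : Pred (Point n d) 0ℓ} (E? : Decidable E) →
         Pr D E? ≡ 𝔼 (point d D) (λ x → 𝟙 (E? x))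
  Pr≡𝔼 {d = d} D E? = trans
    (sumPoints-cong d (λ x → if≡* (does (E? x)) (mass D x)))
    (sumPoints-mass d D _)
    where
    if≡* : ∀ b c → (if b then c else 0#) ≡ c * indicator b
    if≡* true  c = sym (*-identityʳ c)
    if≡* false c = sym (zeroʳ c)

  0≤𝟙 : ∀ {E : Set} (E? : Dec E) → 0# ≤ 𝟙 E?
  0≤𝟙 (yes _) = 0≤1
  0≤𝟙 (no _)  = ≤-refl

  𝟙≤1 : ∀ {E : Set} (E? : Dec E) → 𝟙 E? ≤ 1#
  𝟙≤1 (yes _) = ≤-refl
  𝟙≤1 (no _)  = 0≤1

  Pr-nonNeg : ∀ {n d} (D : ProductDistribution n d) {E : Pred (Point n d) 0ℓ} (E? : Decidable E) →
              0# ≤ Pr D E?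
  Pr-nonNeg D E? = ≤-trans (𝔼-≥ (point _ D) (λ x → 0≤𝟙 (E? x))) (≤-reflexive (sym (Pr≡𝔼 D E?)))

  Pr≤1 : ∀ {n d} (D : ProductDistribution n d) {E : Pred (Point n d) 0ℓ} (E? : Decidable E) →
         Pr D E? ≤ 1#
  Pr≤1 D E? = ≤-trans (≤-reflexive (Pr≡𝔼 D E?)) (𝔼-≤ (point _ D) (λ x → 𝟙≤1 (E? x)))

  Pr-union-bound : ∀ {n d} (D : ProductDistribution n d) {E F G : Pred (Point n d) 0ℓ}
                   (E? : Decidable E) (F? : Decidable F) (G? : Decidable G) →
                   (∀ x → E x → F x ⊎ G x) → Pr D E? ≤ Pr D F? + Pr D G?
  Pr-union-bound {d = d} D E? F? G? E⊆F∪G = begin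
    Pr D E?                                        ≡⟨ Pr≡𝔼 D E? ⟩
    𝔼 (point d D) (λ x → 𝟙 (E? x))                 ≤⟨ 𝔼-mono (point d D) pointwise ⟩
    𝔼 (point d D) (λ x → 𝟙 (F? x) + 𝟙 (G? x))      ≡⟨ 𝔼-+ (point d D) _ _ ⟩
    𝔼 (point d D) (λ x → 𝟙 (F? x)) + 𝔼 (point d D) (λ x → 𝟙 (G? x))
      ≡⟨ cong₂ _+_ (Pr≡𝔼 D F?) (Pr≡𝔼 D G?) ⟨
    Pr D F? + Pr D G?                              ∎
    where
    pointwise : ∀ x → 𝟙 (E? x) ≤ 𝟙 (F? x) + 𝟙 (G? x)
    pointwise x with E? x | F? x | G? x
    ... | no _  | F?x    | G?x    = ≤-trans (0≤𝟙 F?x) (x≤x+y _ (0≤𝟙 G?x))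
    ... | yes _ | yes _  | G?x    = x≤x+y 1# (0≤𝟙 G?x)
    ... | yes _ | no _   | yes _  = ≤-reflexive (sym (+-identityˡ 1#))
    ... | yes e | no ¬f  | no ¬g  with E⊆F∪G x e
    ...   | inj₁ f = ⊥-elim (¬f f)
    ...   | inj₂ g = ⊥-elim (¬g g)

  -- Products with a probability space, and the hitting probability of samples.

  sum-nonNeg : ∀ {n} {f : Fin n → ℝ} → (∀ i → 0# ≤ f i) → 0# ≤ sum f
  sum-nonNeg {zero}  0≤f = ≤-refl
  sum-nonNeg {suc n} 0≤f = ≤-trans (0≤f zero) (x≤x+y _ (sum-nonNeg (0≤f ∘ suc)))

  partialSum-mono : ∀ {a : ℕ → ℝ} → (∀ i → 0# ≤ a i) → ∀ {j k} → j ℕ.≤ k →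
                    ∑[ i < j ] a (toℕ i) ≤ ∑[ i < k ] a (toℕ i)
  partialSum-mono 0≤a {k = k} z≤n = sum-nonNeg {k} (0≤a ∘ toℕ)
  partialSum-mono 0≤a (s≤s j≤k) = +-monoʳ-≤ _ (partialSum-mono (0≤a ∘ suc) j≤k)

  infixr 5 _⊗_

  -- Measurability is required only of the sections over points of `S`, since `e` integrates every
  -- real function on `S`. For countable additivity, the partial sums of the sections increase:
  -- `𝔼-mono` bounds them by the integral of their suprema, and `𝔼-sup` shows that this bound is the
  -- least.
  _⊗_ : ∀ {S} → Expectation S → ProbabilitySpace → ProbabilitySpace
  _⊗_ {S} e P = record
    { Ω            = S × Ω
    ; Measurable   = λ E → ∀ s → Measurable (λ ω → E (s , ω))
    ; μ            = λ E → 𝔼 e (λ s → μ (λ ω → E (s , ω)))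
    ; measurable-≐ = λ (E⊆F , F⊆E) E-meas s → measurable-≐ (E⊆F , F⊆E) (E-meas s)
    ; measurable-U = λ _ → measurable-U
    ; measurable-∁ = λ E-meas s → measurable-∁ (E-meas s)
    ; measurable-⋃ = λ E E-meas s → measurable-⋃ _ (λ k → E-meas k s)
    ; μ-≐          = λ (E⊆F , F⊆E) E-meas → 𝔼-cong e (λ s → μ-≐ (E⊆F , F⊆E) (E-meas s))
    ; μ-nonNeg     = λ E-meas → 𝔼-≥ e (λ s → μ-nonNeg (E-meas s))
    ; μ-U          = trans (𝔼-cong e (λ _ → μ-U)) (𝔼-1 e)
    ; μ-⋃          = λ E E-meas disjoint →
        let section : S → ℕ → Pred Ω 0ℓ
            section s j ω = E j (s , ω)
            series s = μ-⋃ (section s) (λ k → E-meas k s) (λ j k j≢k → disjoint j k j≢k)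
            partial k s = ∑[ j < k ] μ (section s (toℕ j))
            𝔼-partial k = 𝔼-sum e {k} (λ j s → μ (section s (toℕ j)))
        in (λ { _ (k , refl) → ≤-trans (≤-reflexive (sym (𝔼-partial k)))
                                 (𝔼-mono e (λ s → proj₁ (series s) (partial k s) (k , refl))) })
         , (λ b b-upper → 𝔼-sup e {partial}
             (λ j≤k s → partialSum-mono (λ i → μ-nonNeg (E-meas i s)) j≤k)
             (λ s c c-upper → proj₂ (series s) c (λ { _ (k , refl) → c-upper k }))
             b (λ k → ≤-trans (≤-reflexive (𝔼-partial k)) (b-upper _ (k , refl))))
    }
    where open ProbabilitySpace P

  module _ (P : ProbabilitySpace) where
    open ProbabilitySpace P

    measurable-const : ∀ {A : Set} → Dec A → Measurable (λ _ → A)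
    measurable-const (yes a) = measurable-≐ ((λ _ → a) , (λ _ → _)) measurable-U
    measurable-const (no ¬a) = measurable-≐ ((λ ¬u → ⊥-elim (¬u _)) , (λ a → ⊥-elim (¬a a)))
                                            (measurable-∁ measurable-U)

    μ-certain : ∀ {E} → (∀ ω → E ω) → μ E ≡ 1#
    μ-certain E-holds = trans (sym (μ-≐ ((λ {ω} _ → E-holds ω) , (λ _ → _)) measurable-U)) μ-U

  -- By independence, `k` draws all miss `E` with probability `q ^ k`, and the indicator of `any?`
  -- integrates to the complementary probability. The induction conditions on the first draw.
  q^k+𝔼-any≡1 : ∀ {S} (e : Expectation S) {E : Pred S 0ℓ} (E? : Decidable E) {p q} →
           𝔼 e (λ s → 𝟙 (E? s)) ≡ p → q + p ≡ 1# → ∀ k →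
           q ^ k + 𝔼 (samples k e) (λ ss → 𝟙 (any? E? ss)) ≡ 1#
  q^k+𝔼-any≡1 e E? 𝔼≡p q+p≡1 zero = +-identityʳ 1#
  q^k+𝔼-any≡1 e E? {p} {q} 𝔼≡p q+p≡1 (suc k) = begin-equality
    q * q ^ k + 𝔼 e (λ s → 𝔼 (samples k e) (λ ss → 𝟙 (any? E? (s ∷ ss))))
      ≡⟨ cong (q * q ^ k +_) (𝔼-cong e λ s → first (E? s)) ⟩
    q * q ^ k + 𝔼 e (λ s → q ^ k * 𝟙 (E? s) + c)
      ≡⟨ cong (q * q ^ k +_) (𝔼-+ e _ _) ⟩
    q * q ^ k + (𝔼 e (λ s → q ^ k * 𝟙 (E? s)) + 𝔼 e (λ _ → c))
      ≡⟨ cong (q * q ^ k +_) (cong₂ _+_ (trans (𝔼-* e _ _) (cong (q ^ k *_) 𝔼≡p)) (𝔼-const e c)) ⟩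
    q * q ^ k + (q ^ k * p + c)
      ≡⟨ solve 4 (λ p q y c → q :* y :+ (y :* p :+ c) := (q :+ p) :* y :+ c) refl p q (q ^ k) c ⟩
    (q + p) * q ^ k + c
      ≡⟨ cong (λ t → t * q ^ k + c) q+p≡1 ⟩
    1# * q ^ k + c
      ≡⟨ cong (_+ c) (*-identityˡ (q ^ k)) ⟩
    q ^ k + c
      ≡⟨ q^k+c≡1 ⟩
    1# ∎
    where
    c = 𝔼 (samples k e) (λ ss → 𝟙 (any? E? ss))
    q^k+c≡1 = q^k+𝔼-any≡1 e E? 𝔼≡p q+p≡1 k
    -- A first draw that misses leaves `c`, and one that hits gives `1# ≡ q ^ k + c`. Both values
    -- fit one formula affine in the indicator, so that linearity of `𝔼` can finish the computation.
    first : ∀ {A : Set} (A? : Dec A) →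
            𝔼 (samples k e) (λ ss → indicator (does A? ∨ does (any? E? ss))) ≡ q ^ k * 𝟙 A? + c
    first (no _)  = sym (trans (cong (_+ c) (zeroʳ (q ^ k))) (+-identityˡ c))
    first (yes _) = begin-equality
      𝔼 (samples k e) (λ _ → 1#) ≡⟨ 𝔼-1 (samples k e) ⟩
      1#                         ≡⟨ q^k+c≡1 ⟨
      q ^ k + c                  ≡⟨ cong (_+ c) (*-identityʳ (q ^ k)) ⟨
      q ^ k * 1# + c             ∎

  -- Let `y` be `q ^ k`. Bernoulli with `k p ≥ 3` gives `4 y ≤ 1`, while `c ≤ 2/3` would give
  -- `3 y ≥ 1`. Subtracting leaves `y ≤ 0`, which contradicts the latter.
  2/3<1-q^k : ∀ {p q c} k → 0# ≤ p → 0# ≤ q → q + p ≡ 1# → fromℕ 3 ≤ fromℕ k * p →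
              q ^ k + c ≡ 1# → fromℕ 2 / fromℕ 3 < c
  2/3<1-q^k {p} {q} {c} k 0≤p 0≤q q+p≡1 3≤kp y+c≡1 = ≰⇒> λ c≤2/3 →
    let 1≤3y : 1# ≤ y * fromℕ 3
        1≤3y = +-cancelʳ-≤ (fromℕ 2) (begin
          fromℕ 3                   ≡⟨ *-identityˡ (fromℕ 3) ⟨
          1# * fromℕ 3              ≡⟨ cong (_* fromℕ 3) y+c≡1 ⟨
          (y + c) * fromℕ 3         ≡⟨ distribʳ (fromℕ 3) y c ⟩
          y * fromℕ 3 + c * fromℕ 3 ≤⟨ +-monoʳ-≤ _ (x≤z/y⇒x*y≤z (fromℕ-pos 2) c≤2/3) ⟩
          y * fromℕ 3 + fromℕ 2     ∎)
        y≤0 : y ≤ 0#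
        y≤0 = +-cancelʳ-≤ (y * fromℕ 3) (begin
          y + y * fromℕ 3           ≡⟨ cong (_+ y * fromℕ 3) (*-identityʳ y) ⟨
          y * 1# + y * fromℕ 3      ≡⟨ distribˡ y 1# (fromℕ 3) ⟨
          y * (1# + fromℕ 3)        ≤⟨ *-monoˡ-≤ (^-nonNeg k 0≤q) (+-monoʳ-≤ 1# 3≤kp) ⟩
          y * (1# + fromℕ k * p)    ≤⟨ bernoulli k 0≤p 0≤q q+p≡1 ⟩
          1#                        ≤⟨ 1≤3y ⟩
          y * fromℕ 3               ≡⟨ +-identityˡ _ ⟨
          0# + y * fromℕ 3          ∎)
    in <⇒≱ 0<1 (begin
      1#           ≤⟨ 1≤3y ⟩
      y * fromℕ 3  ≤⟨ *-monoʳ-≤ (fromℕ-nonNeg 3) y≤0 ⟩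
      0# * fromℕ 3 ≡⟨ zeroˡ (fromℕ 3) ⟩
      0#           ∎)
    where
    y = q ^ k

  allPoints : ∀ n d → Vec (Point n d) (n ℕ.^ d)
  allPoints n zero    = [] ∷ []
  allPoints n (suc d) = Vec.map (uncurry _∷_) (Vec.allPairs (Vec.allFin n) (allPoints n d))

  ∈-allPoints : ∀ {n d} (x : Point n d) → x ∈ allPoints n d
  ∈-allPoints []      = here refl
  ∈-allPoints (i ∷ x) = ∈-map⁺ (uncurry _∷_) (∈-allPairs⁺ (∈-allFin⁺ i) (∈-allPoints x))

  -- The bound on suc k leaves one query for the top point.
  record Sampler {n d} (D : ProductDistribution n d) (ε : ℝ) : Set₁ where
    field
      k         : ℕ
      1+k≤10/ε  : fromℕ (suc k) ≤ fromℕ 10 / ε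
      sample    : Expectation (Vec (Point n d) k)
      hits      : ∀ {E : Pred (Point n d) 0ℓ} (E? : Decidable E) → ε < Pr D E? →
                  fromℕ 2 / fromℕ 3 < 𝔼 sample (λ xs → 𝟙 (any? E? xs))

  -- The cutoff of boundedFloor is harmless: with as many queries as there are
  -- points, the sample can simply be the whole domain.
  sampler : ∀ {n d} (D : ProductDistribution n d) (ε : ℝ) → 0# < ε → ε ≤ 1# → Sampler D ε
  sampler {n} {d} D ε 0<ε ε≤1 with boundedFloor (n ℕ.^ d) (fromℕ 10 / ε) 1≤10/ε
    where
    1≤10/ε : fromℕ 1 ≤ fromℕ 10 / ε
    1≤10/ε = x*y≤z⇒x≤z/y 0<ε (begin
      fromℕ 1 * ε ≤⟨ *-monoˡ-≤ (fromℕ-nonNeg 1) ε≤1 ⟩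
      fromℕ 1 * 1# ≡⟨ *-identityʳ (fromℕ 1) ⟩
      fromℕ 1 ≤⟨ fromℕ-mono-≤ (ℕ.m≤m+n 1 9) ⟩
      fromℕ 10 ∎)
  ... | inj₁ 1+N≤10/ε = record
    { 1+k≤10/ε = 1+N≤10/ε
    ; sample   = dirac (allPoints n d)
    ; hits     = hits
    }
    where
    hits : ∀ {E : Pred (Point n d) 0ℓ} (E? : Decidable E) → ε < Pr D E? →
           fromℕ 2 / fromℕ 3 < 𝟙 (any? E? (allPoints n d))
    hits E? ε<Pr with any? E? (allPoints n d)
    ... | yes _   = 2/3<1
    ... | no none = ⊥-elim (<⇒≱ 0<ε (begin
      ε                                ≤⟨ proj₁ ε<Pr ⟩
      Pr D E?                          ≡⟨ Pr≡𝔼 D E? ⟩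
      𝔼 (point d D) (λ x → 𝟙 (E? x))   ≤⟨ 𝔼-≤ (point d D) (λ x → 𝟙≤0 (E? x)
                                            (none ∘ lose (∈-allPoints x))) ⟩
      0#                               ∎))
      where
      𝟙≤0 : ∀ {A : Set} (A? : Dec A) → ¬ A → 𝟙 A? ≤ 0#
      𝟙≤0 (yes a) ¬a = ⊥-elim (¬a a)
      𝟙≤0 (no _)  ¬a = ≤-refl
  ... | inj₂ (k , 1+k≤10/ε , 10/ε≤2+k) = record
    { 1+k≤10/ε = 1+k≤10/ε
    ; sample   = samples k (point d D)
    ; hits     = λ E? ε<Pr →
        let p = Pr D E?
            q+p≡1 = y-x+x≡y p 1#
        in 2/3<1-q^k k (Pr-nonNeg D E?) (x≤y⇒0≤y-x (Pr≤1 D E?)) q+p≡1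
             (3≤kp p (proj₁ ε<Pr) (Pr≤1 D E?))
             (q^k+𝔼-any≡1 (point d D) E? (sym (Pr≡𝔼 D E?)) q+p≡1 k)
    }
    where
    -- This is where the constant 10 is spent: `10 ≤ (2 + k) p ≤ 2 + k p`, hence `k p ≥ 8`, more
    -- than the required 3. Of the 2 given away, one pays for the query of the top point and one for
    -- rounding `10 / ε` down.
    3≤kp : ∀ p → ε ≤ p → p ≤ 1# → fromℕ 3 ≤ fromℕ k * p
    3≤kp p ε≤p p≤1 = ≤-trans (fromℕ-mono-≤ (ℕ.m≤m+n 3 5)) (+-cancelˡ-≤ (fromℕ 2) (begin
      fromℕ 2 + fromℕ 8         ≡⟨ fromℕ-+ 2 8 ⟨
      fromℕ 10                  ≡⟨ x/y*y≡x (fromℕ 10) 0<ε ⟨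
      fromℕ 10 / ε * ε          ≤⟨ *-monoʳ-≤ (proj₁ 0<ε) 10/ε≤2+k ⟩
      fromℕ (2 ℕ.+ k) * ε       ≤⟨ *-monoˡ-≤ (fromℕ-nonNeg (2 ℕ.+ k)) ε≤p ⟩
      fromℕ (2 ℕ.+ k) * p       ≡⟨ cong (_* p) (fromℕ-+ 2 k) ⟩
      (fromℕ 2 + fromℕ k) * p   ≡⟨ distribʳ p (fromℕ 2) (fromℕ k) ⟩
      fromℕ 2 * p + fromℕ k * p ≤⟨ +-monoˡ-≤ _ (*-monoˡ-≤ (fromℕ-nonNeg 2) p≤1) ⟩
      fromℕ 2 * 1# + fromℕ k * p ≡⟨ cong (_+ fromℕ k * p) (*-identityʳ (fromℕ 2)) ⟩
      fromℕ 2 + fromℕ k * p     ∎))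

-- Monotonicity on the grid and discrete antiderivatives.

module Embedding (R : RealNumbers) where
  open PropertyTesting R
  open OrderedField R
  open ≤-Reasoning

  line-mono : ∀ {m} (φ : Fin (suc m) → ℝ) → (∀ i → φ (inject₁ i) ≤ φ (suc i)) →
              ∀ {i j} → i Fin.≤ j → φ i ≤ φ j
  line-mono φ step {zero} {zero} _ = ≤-refl
  line-mono {suc m} φ step {zero} {suc j} _ =
    ≤-trans (step zero) (line-mono (φ ∘ suc) (step ∘ suc) {zero} {j} z≤n)
  line-mono {suc m} φ step {suc i} {suc j} (s≤s i≤j) =
    line-mono (φ ∘ suc) (step ∘ suc) i≤j

  -- A path from `x` to `y` that raises the coordinates one after another, beginning with the first,
  -- consists of unit steps only.
  grid-mono : ∀ {m d} (φ : Point (suc m) d → ℝ) →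
              (∀ x r i → lookup x r ≡ inject₁ i → φ x ≤ φ (x [ r ]≔ suc i)) →
              ∀ x y → (∀ r → lookup x r Fin.≤ lookup y r) → φ x ≤ φ y
  grid-mono φ step []      []      x≤y = ≤-refl
  grid-mono φ step (i ∷ x) (j ∷ y) x≤y = ≤-trans
    (line-mono (λ k → φ (k ∷ x)) (λ k → step (inject₁ k ∷ x) zero k refl) (x≤y zero))
    (grid-mono (λ z → φ (j ∷ z)) (λ z r → step (j ∷ z) (suc r)) x y (x≤y ∘ suc))

  x≤x[r]≔suc : ∀ {m d} (x : Point (suc m) d) r i → lookup x r ≡ inject₁ i →
               ∀ s → lookup x s Fin.≤ lookup (x [ r ]≔ suc i) s
  x≤x[r]≔suc (_ ∷ x) zero    i refl zero    = ℕ.≤-trans (ℕ.≤-reflexive (toℕ-inject₁ i)) (ℕ.n≤1+n _)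
  x≤x[r]≔suc (_ ∷ x) zero    i xᵣ≡i (suc s) = ℕ.≤-refl
  x≤x[r]≔suc (_ ∷ x) (suc r) i xᵣ≡i zero    = ℕ.≤-refl
  x≤x[r]≔suc (_ ∷ x) (suc r) i xᵣ≡i (suc s) = x≤x[r]≔suc x r i xᵣ≡i s

  top : ∀ {m} d → Point (suc m) d
  top {m} d = replicate d (Fin.fromℕ m)

  x≤top : ∀ {m d} (x : Point (suc m) d) → ∀ r → lookup x r Fin.≤ lookup (top d) r
  x≤top x r = subst (lookup x r Fin.≤_) (sym (lookup-replicate r _)) (≤fromℕ (lookup x r))

  antiderivative : ∀ {m} → (Fin m → ℝ) → Fin (suc m) → ℝ
  antiderivative         l zero    = 0#
  antiderivative {suc m} l (suc i) = l zero + antiderivative (l ∘ suc) i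

  -- The recursion of `antiderivative` splits off the lowest summand, whereas a derivative needs the
  -- highest one; induction moves the latter to the front.
  antiderivative-step : ∀ {m} (l : Fin m → ℝ) i →
                        antiderivative l (suc i) ≡ l i + antiderivative l (inject₁ i)
  antiderivative-step {suc m} l zero    = refl
  antiderivative-step {suc m} l (suc i) = begin-equality
    l zero + antiderivative (l ∘ suc) (suc i)
      ≡⟨ cong (l zero +_) (antiderivative-step (l ∘ suc) i) ⟩
    l zero + (l (suc i) + antiderivative (l ∘ suc) (inject₁ i))
      ≡⟨ solve 3 (λ x y z → x :+ (y :+ z) := y :+ (x :+ z)) refl (l zero) (l (suc i)) _ ⟩
    l (suc i) + (l zero + antiderivative (l ∘ suc) (inject₁ i)) ∎

  -- This is the function `L`. It exists because `l r` depends on coordinate `r` alone: a sum of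
  -- one-variable antiderivatives has all the prescribed derivatives at once.
  potential : ∀ {m d} → (Fin d → Fin m → ℝ) → Point (suc m) d → ℝ
  potential l []      = 0#
  potential l (i ∷ x) = antiderivative (l zero) i + potential (l ∘ suc) x

  potential-step : ∀ {m d} (l : Fin d → Fin m → ℝ) x r i → lookup x r ≡ inject₁ i →
                   potential l (x [ r ]≔ suc i) ≡ l r i + potential l x
  potential-step l (_ ∷ x) zero    i refl = trans
    (cong (_+ potential (l ∘ suc) x) (antiderivative-step (l zero) i)) (+-assoc _ _ _)
  potential-step l (j ∷ x) (suc r) i xᵣ≡i = trans
    (cong (antiderivative (l zero) j +_) (potential-step (l ∘ suc) x r i xᵣ≡i))
    (solve 3 (λ x y z → x :+ (y :+ z) := y :+ (x :+ z)) refl _ (l (suc r) i) _)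

  -- Positive minima and rounding to multiples.

  lowerBound : ∀ {n} (w : Fin n → ℝ) → (∀ i → 0# < w i) → ∃[ ρ ] 0# < ρ × (∀ i → ρ ≤ w i)
  -- Any positive number serves for an empty family; this occurs when the grid has no direction or a
  -- single point per line.
  lowerBound {zero}  w 0<w = 1# , 0<1 , λ ()
  lowerBound {suc n} w 0<w with lowerBound (w ∘ suc) (0<w ∘ suc)
  ... | ρ , 0<ρ , ρ≤w with ≤-total ρ (w zero)
  ...   | inj₁ ρ≤w₀ = ρ , 0<ρ , λ { zero → ρ≤w₀ ; (suc i) → ρ≤w i }
  ...   | inj₂ w₀≤ρ = w zero , 0<w zero , λ { zero → ≤-refl ; (suc i) → ≤-trans w₀≤ρ (ρ≤w i) }

  -- The largest positive `v ≤ k` with `δ * fromℕ v ≤ z`, or 0 if there is none. Negative `z` is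
  -- thus sent to 0, and truncation at both ends preserves monotonicity in `z`.
  roundDown : ℝ → ℕ → ℝ → ℕ
  roundDown δ zero    z = 0
  roundDown δ (suc k) z = if does (δ * fromℕ (suc k) ≤? z) then suc k else roundDown δ k z

  roundDown-≤ : ∀ δ k z → roundDown δ k z ℕ.≤ k
  roundDown-≤ δ zero    z = z≤n
  roundDown-≤ δ (suc k) z with δ * fromℕ (suc k) ≤? z
  ... | yes _ = ℕ.≤-refl
  ... | no _  = ℕ.m≤n⇒m≤1+n (roundDown-≤ δ k z)

  roundDown-mono : ∀ δ k {y z} → y ≤ z → roundDown δ k y ℕ.≤ roundDown δ k z
  roundDown-mono δ zero    y≤z = z≤n
  roundDown-mono δ (suc k) {y} {z} y≤z with δ * fromℕ (suc k) ≤? y | δ * fromℕ (suc k) ≤? z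
  ... | yes _   | yes _   = ℕ.≤-refl
  ... | yes k≤y | no  k≰z = ⊥-elim (k≰z (≤-trans k≤y y≤z))
  ... | no  _   | yes _   = ℕ.m≤n⇒m≤1+n (roundDown-≤ δ k y)
  ... | no  _   | no  _   = roundDown-mono δ k y≤z

  roundDown-multiple : ∀ {δ} → 0# < δ → ∀ k {v} → v ℕ.≤ k → roundDown δ k (δ * fromℕ v) ≡ v
  roundDown-multiple 0<δ zero z≤n = refl
  roundDown-multiple {δ} 0<δ (suc k) {v} v≤1+k with δ * fromℕ (suc k) ≤? δ * fromℕ v
  ... | yes δk≤δv = ℕ.≤-antisym (fromℕ-cancel-≤ (*-cancelˡ-≤ 0<δ δk≤δv)) v≤1+k
  ... | no  δk≰δv = roundDown-multiple 0<δ k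
          (ℕ.m<1+n⇒m≤n (ℕ.≤∧≢⇒< v≤1+k λ { refl → δk≰δv ≤-refl }))

  -- The embedding into `𝒫 B` and its decoding.

  module _ {m d} (B : BoundingFamily m d) where
    open BoundingFamily B

    rowGap : ∀ r → ∃[ ρ ] 0# < ρ × (∀ y → ρ ≤ u r y - l r y)
    rowGap r = lowerBound _ (λ y → x<y⇒0<y-x (l<u r y))

    gap : ∃[ ρ ] 0# < ρ × (∀ r y → ρ ≤ u r y - l r y)
    gap with lowerBound (proj₁ ∘ rowGap) (proj₁ ∘ proj₂ ∘ rowGap)
    ... | ρ , 0<ρ , ρ≤row = ρ , 0<ρ , λ r y → ≤-trans (ρ≤row r) (proj₂ (proj₂ (rowGap r)) y)

    -- Dividing by `suc M` rather than `M` keeps the divisor positive when `M` is 0.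
    scale : ℕ → ℝ
    scale M = proj₁ gap / fromℕ (suc M)

    0<scale : ∀ M → 0# < scale M
    0<scale M = /-pos (proj₁ (proj₂ gap)) (fromℕ-pos M)

    -- Values v ≤ M move the derivatives within [l , u], since scale M * M ≤ u - l.
    embed : ℕ → Point (suc m) d → ℕ → ℝ
    embed M x v = potential l x + scale M * fromℕ v

    scale*v+l≤u : ∀ M {v} → v ℕ.≤ M → ∀ r y → scale M * fromℕ v + l r y ≤ u r y
    scale*v+l≤u M {v} v≤M r y = x≤y-z⇒x+z≤y (begin
      scale M * fromℕ v       ≤⟨ *-monoˡ-≤ (proj₁ (0<scale M)) (fromℕ-mono-≤ (ℕ.m≤n⇒m≤1+n v≤M)) ⟩
      scale M * fromℕ (suc M) ≡⟨ x/y*y≡x (proj₁ gap) (fromℕ-pos M) ⟩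
      proj₁ gap               ≤⟨ proj₂ (proj₂ gap) r y ⟩
      u r y - l r y           ∎)

    -- An increment of the embedding exceeds `l r i` by `scale M` times the increment of `f`. That
    -- increment is nonnegative by monotonicity and at most `f x′`, because `f x` is a natural
    -- number; `scale*v+l≤u` then applies.
    embed-∈𝒫 : ∀ M (f : Function (suc m) d ℕ) → Monotone f → (∀ x → f x ℕ.≤ M) →
               𝒫 B (λ x → embed M x (f x))
    embed-∈𝒫 M f f-mono f≤M r x i xᵣ≡i = x+z≤y⇒x≤y-z lower , x≤y+z⇒x-z≤y upper
      where
      x′ = x [ r ]≔ suc i
      δ  = scale M
      L  = potential l x
      lower : l r i + embed M x (f x) ≤ embed M x′ (f x′)
      lower = begin
        l r i + (L + δ * fromℕ (f x))            ≡⟨ +-assoc _ _ _ ⟨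
        l r i + L + δ * fromℕ (f x)              ≡⟨ cong (_+ δ * fromℕ (f x)) (potential-step l x r i xᵣ≡i) ⟨
        potential l x′ + δ * fromℕ (f x)         ≤⟨ +-monoʳ-≤ _ (*-monoˡ-≤ (proj₁ (0<scale M))
                                                      (fromℕ-mono-≤ (f-mono x x′ (x≤x[r]≔suc x r i xᵣ≡i)))) ⟩
        potential l x′ + δ * fromℕ (f x′)        ∎
      upper : embed M x′ (f x′) ≤ u r i + embed M x (f x)
      upper = begin
        potential l x′ + δ * fromℕ (f x′)        ≡⟨ cong (_+ δ * fromℕ (f x′)) (potential-step l x r i xᵣ≡i) ⟩
        l r i + L + δ * fromℕ (f x′)
          ≡⟨ solve 3 (λ x y z → x :+ y :+ z := z :+ x :+ y) refl (l r i) L (δ * fromℕ (f x′)) ⟩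
        δ * fromℕ (f x′) + l r i + L             ≤⟨ +-mono-≤ (scale*v+l≤u M (f≤M x′) r i)
                                                      (x≤x+y L (*-nonNeg (proj₁ (0<scale M)) (fromℕ-nonNeg (f x)))) ⟩
        u r i + (L + δ * fromℕ (f x))            ∎

    decode : ℕ → Function (suc m) d ℝ → Function (suc m) d ℕ
    decode M h x = roundDown (scale M) M (h x - potential l x)

    decode-monotone : ∀ M h → 𝒫 B h → Monotone (decode M h)
    decode-monotone M h h∈𝒫 x y x≤y =
      roundDown-mono (scale M) M (grid-mono (λ z → h z - potential l z) step x y x≤y)
      where
      step : ∀ x r i → lookup x r ≡ inject₁ i →
             h x - potential l x ≤ h (x [ r ]≔ suc i) - potential l (x [ r ]≔ suc i)
      step x r i xᵣ≡i = x+z≤y⇒x≤y-z (begin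
        h x - potential l x + potential l (x [ r ]≔ suc i)
          ≡⟨ cong (h x - potential l x +_) (potential-step l x r i xᵣ≡i) ⟩
        h x - potential l x + (l r i + potential l x)
          ≡⟨ solve 3 (λ x y z → x :+ (y :+ z) := y :+ (x :+ z)) refl _ (l r i) _ ⟩
        l r i + (h x - potential l x + potential l x)
          ≡⟨ cong (l r i +_) (y-x+x≡y (potential l x) (h x)) ⟩
        l r i + h x
          ≤⟨ x≤y-z⇒x+z≤y (proj₁ (h∈𝒫 r x i xᵣ≡i)) ⟩
        h (x [ r ]≔ suc i) ∎)

    decode-embed : ∀ M h x {v} → v ℕ.≤ M → embed M x v ≡ h x → decode M h x ≡ v
    decode-embed M h x {v} v≤M embed≡h = trans
      (cong (roundDown (scale M) M) (begin-equality
        h x - potential l x                              ≡⟨ cong (_- potential l x) embed≡h ⟨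
        potential l x + scale M * fromℕ v - potential l x ≡⟨ cong (_- potential l x) (+-comm _ _) ⟩
        scale M * fromℕ v + potential l x - potential l x ≡⟨ y+x-x≡y _ _ ⟩
        scale M * fromℕ v                                ∎))
      (roundDown-multiple (0<scale M) M v≤M)

  -- The infimum is the supremum of the lower bounds.
  infimum : (S : Pred ℝ 0ℓ) → ∃[ x ] S x → ∃[ b ] (∀ x → S x → b ≤ x) → ∃[ s ] IsInfimum _≤_ S s
  infimum S (x , x∈S) (b , b≤S)
    with complete (λ b → ∀ x → S x → b ≤ x) (b , b≤S) (x , λ b b≤S → b≤S x x∈S)
  ... | s , upper , least = s , (λ y y∈S → least y (λ b b≤S → b≤S y y∈S)) , upper

-- Distance to monotonicity compared with distance to `𝒫 B`.

module Reduction (R : RealNumbers) {m d : ℕ} (D : PropertyTesting.ProductDistribution R (suc m) d)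
                 (B : PropertyTesting.BoundingFamily R m d) where
  open PropertyTesting R
  open OrderedField R
  open Expectations R
  open Expectation
  open Embedding R
  open ≤-Reasoning

  realDistance : ℕ → Function (suc m) d ℕ → Function (suc m) d ℝ → ℝ
  realDistance M f h = Pr D (λ x → ¬? (embed B M x (f x) ≟ h x))

  -- At a point where `f` is at most `M`, agreement of `h` with the embedding forces the decoded
  -- value to equal that of `f`. Each disagreement after decoding therefore falls under one of two
  -- events, and the union bound applies.
  decode-distance : ∀ M f h → Pr D (λ x → ¬? (f x ≟ℕ decode B M h x)) ≤
                              realDistance M f h + Pr D (λ x → M ℕ.<? f x)
  decode-distance M f h = Pr-union-bound D
    (λ x → ¬? (f x ≟ℕ decode B M h x)) (λ x → ¬? (embed B M x (f x) ≟ h x)) (λ x → M ℕ.<? f x) cover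
    where
    cover : ∀ x → f x ≢ decode B M h x → embed B M x (f x) ≢ h x ⊎ M ℕ.< f x
    cover x f≢decode with M ℕ.<? f x
    ... | yes M<fx = inj₂ M<fx
    ... | no  M≮fx = inj₁ λ embed≡h → f≢decode (sym (decode-embed B M h x (ℕ.≮⇒≥ M≮fx) embed≡h))

  -- The zero function is monotone, so its embedding witnesses that `𝒫 B` is inhabited. The set of
  -- distances in `embed-far` is then nonempty and has an infimum.
  potential-∈𝒫 : 𝒫 B (λ x → embed B 0 x 0)
  potential-∈𝒫 = embed-∈𝒫 B 0 (λ _ → 0) (λ _ _ _ → z≤n) (λ _ → z≤n)

  2ε<δ⇒ε<δ-ε : ∀ {ε δ} → fromℕ 2 * ε < δ → ε < δ - ε
  2ε<δ⇒ε<δ-ε {ε} {δ} 2ε<δ = ≰⇒> λ δ-ε≤ε → <⇒≱ 2ε<δ (begin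
    δ              ≡⟨ y-x+x≡y ε δ ⟨
    δ - ε + ε      ≤⟨ +-monoˡ-≤ ε δ-ε≤ε ⟩
    ε + ε          ≡⟨ solve 1 (λ x → x :+ x := (con 1 :+ con 1) :* x) refl ε ⟩
    (1# + 1#) * ε  ≡⟨ cong (λ t → (1# + t) * ε) (+-identityʳ 1#) ⟨
    fromℕ 2 * ε    ∎)

  -- Decoding turns every `h` in `𝒫 B` into a monotone competitor for `f` at the cost of at most
  -- `ε`. Hence `δ - ε`, which exceeds `ε`, lies below all the real distances and so below their
  -- infimum. As `Far` asks for that infimum itself, completeness has to supply it.
  embed-far : ∀ M f {ε} → Pr D (λ x → M ℕ.<? f x) ≤ ε →
              Far _≟ℕ_ D Monotone (fromℕ 2 * ε) f →
              Far _≟_ D (𝒫 B) ε (λ x → embed B M x (f x))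
  embed-far M f {ε} Pr≤ε (δ , (δ-lower , _) , 2ε<δ) =
    δ′ , isInf , <-≤-trans (2ε<δ⇒ε<δ-ε 2ε<δ) (proj₂ isInf (δ - ε) δ-ε-lower)
    where
    Distance : Pred ℝ 0ℓ
    Distance p = ∃[ h ] 𝒫 B h × p ≡ realDistance M f h

    δ-ε-lower : ∀ p → Distance p → δ - ε ≤ p
    δ-ε-lower p (h , h∈𝒫 , refl) = x≤y+z⇒x-z≤y (begin
      δ                                             ≤⟨ δ-lower _ (decode B M h , decode-monotone B M h h∈𝒫 , refl) ⟩
      Pr D (λ x → ¬? (f x ≟ℕ decode B M h x))       ≤⟨ decode-distance M f h ⟩
      realDistance M f h + Pr D (λ x → M ℕ.<? f x)  ≤⟨ +-monoʳ-≤ (realDistance M f h) Pr≤ε ⟩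
      realDistance M f h + ε                        ∎)

    distance-infimum : ∃[ δ′ ] IsInfimum _≤_ Distance δ′
    distance-infimum = infimum Distance
      (realDistance M f (λ x → embed B 0 x 0) , (λ x → embed B 0 x 0) , potential-∈𝒫 , refl)
      (δ - ε , δ-ε-lower)

    δ′ = proj₁ distance-infimum

    isInf : IsInfimum _≤_ Distance δ′
    isInf = proj₂ distance-infimum

  -- If ε ≥ 1, no function is 2ε-far.
  trivialTester : ∀ {ε q} → 1# ≤ ε → 0# ≤ q → ProbabilitySpace →
                  Tester _≟ℕ_ D Monotone (fromℕ 2 * ε) q
  trivialTester {ε} 1≤ε 0≤q P = record
    { space      = P
    ; tree       = λ _ → output true
    ; measurable = λ _ b → measurable-const P (true Bool.≟ b)
    ; bounded    = λ _ _ → 0≤q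
    ; accepts    = λ _ _ → <-≤-trans 2/3<1 (≤-reflexive (sym (μ-certain P (λ _ → refl))))
    ; rejects    = λ f (δ , (lower , _) , 2ε<δ) → ⊥-elim (<⇒≱ 2ε<δ (begin
        δ            ≤⟨ lower _ ((λ _ → 0) , (λ _ _ _ → z≤n) , refl) ⟩
        Pr D (λ x → ¬? (f x ≟ℕ 0)) ≤⟨ Pr≤1 D (λ x → ¬? (f x ≟ℕ 0)) ⟩
        1#           ≡⟨ +-identityʳ 1# ⟨
        fromℕ 1      ≤⟨ fromℕ-mono-≤ (ℕ.n≤1+n 1) ⟩
        fromℕ 2      ≡⟨ *-identityʳ (fromℕ 2) ⟨
        fromℕ 2 * 1# ≤⟨ *-monoˡ-≤ (fromℕ-nonNeg 2) 1≤ε ⟩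
        fromℕ 2 * ε  ∎))
    }

  -- Transformations of decision trees and the combined tester.

  pullback : ∀ {n d} {A A′ : Set} → (Point n d → A → A′) → DecisionTree n d A′ → DecisionTree n d A
  pullback φ (output b)  = output b
  -- The simulated answer depends on the point as well as on the value, since `embed` adds the
  -- potential at `x`.
  pullback φ (query x k) = query x (λ v → pullback φ (k (φ x v)))

  run-pullback : ∀ {n d} {A A′ : Set} (φ : Point n d → A → A′) t (f : Function n d A) →
                 run (pullback φ t) f ≡ run t (λ x → φ x (f x))
  run-pullback φ (output b)  f = refl
  run-pullback φ (query x k) f = run-pullback φ (k (φ x (f x))) f

  #queries-pullback : ∀ {n d} {A A′ : Set} (φ : Point n d → A → A′) t (f : Function n d A) →
                      #queries (pullback φ t) f ≡ #queries t (λ x → φ x (f x))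
  #queries-pullback φ (output b)  f = refl
  #queries-pullback φ (query x k) f = cong suc (#queries-pullback φ (k (φ x (f x))) f)

  screen : ∀ {n d k} → ℕ → Vec (Point n d) k → DecisionTree n d ℕ → DecisionTree n d ℕ
  screen M []       t = t
  screen M (x ∷ xs) t = query x (λ v → if does (M ℕ.<? v) then output false else screen M xs t)

  run-screen : ∀ {n d k} M (xs : Vec (Point n d) k) t f →
               run (screen M xs t) f ≡
               (if does (any? (λ x → M ℕ.<? f x) xs) then false else run t f)
  run-screen M []       t f = refl
  run-screen M (x ∷ xs) t f with does (M ℕ.<? f x)
  ... | true  = refl
  ... | false = run-screen M xs t f

  #queries-screen : ∀ {n d k} M (xs : Vec (Point n d) k) t f →
                    #queries (screen M xs t) f ℕ.≤ k ℕ.+ #queries t f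
  #queries-screen M []       t f = ℕ.≤-refl
  #queries-screen M (x ∷ xs) t f with does (M ℕ.<? f x)
  ... | true  = s≤s z≤n
  ... | false = s≤s (#queries-screen M xs t f)

  samplingTester : ∀ {ε} Q → 0# < ε → Sampler D ε → Tester _≟_ D (𝒫 B) ε (fromℕ Q) →
                   Tester _≟ℕ_ D Monotone (fromℕ 2 * ε) (fromℕ Q + fromℕ 10 / ε)
  samplingTester {ε} Q 0<ε S T = record
    { space      = sample ⊗ T.space
    ; tree       = tree
    ; measurable = measurable
    ; bounded    = bounded
    ; accepts    = λ f f-mono → <-≤-trans
        (T.accepts (encode f) (embed-∈𝒫 B (f (top d)) f f-mono (λ x → f-mono x (top d) (x≤top x))))
        -- A monotone `f` never exceeds its value at the top point, so the screening rejects nothing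
        -- and every section keeps the acceptance probability of the given tester.
        (𝔼-≥ sample (λ xs → ≤-reflexive (sym (μ-pass f xs true (no-violation f f-mono xs)))))
    ; rejects    = rejects
    }
    where
    open Sampler S
    module T = Tester T
    encode : Function (suc m) d ℕ → Function (suc m) d ℝ
    encode f x = embed B (f (top d)) x (f x)

    tree : Vec (Point (suc m) d) k × T.Ω → DecisionTree (suc m) d ℕ
    -- The scale of the embedding depends on `M`, known only after this query; it is the extra query
    -- counted by `suc k` in `Sampler`.
    tree (xs , ω) = query (top d) (λ M → screen M xs (pullback (embed B M) (T.tree ω)))

    violates? : ∀ f → Decidable (λ x → f (top d) ℕ.< f x)
    violates? f x = f (top d) ℕ.<? f x

    run-tree : ∀ f xs ω → run (tree (xs , ω)) f ≡
               (if does (any? (violates? f) xs) then false else run (T.tree ω) (encode f))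
    run-tree f xs ω = trans (run-screen (f (top d)) xs _ f)
      (cong (λ b → if does (any? (violates? f) xs) then false else b)
            (run-pullback (embed B (f (top d))) (T.tree ω) f))

    outcome : ∀ f b xs → Pred T.Ω 0ℓ
    outcome f b xs ω = run (tree (xs , ω)) f ≡ b

    pass-≐ : ∀ f xs b → does (any? (violates? f) xs) ≡ false →
             (λ ω → run (T.tree ω) (encode f) ≡ b) ≐ outcome f b xs
    pass-≐ f xs b none = (λ {ω} eq → trans (run≡ ω) eq) , (λ {ω} eq → trans (sym (run≡ ω)) eq)
      where
      run≡ : ∀ ω → run (tree (xs , ω)) f ≡ run (T.tree ω) (encode f)
      run≡ ω = trans (run-tree f xs ω)
        (cong (λ c → if c then false else run (T.tree ω) (encode f)) none)

    μ-pass : ∀ f xs b → does (any? (violates? f) xs) ≡ false →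
             T.μ (outcome f b xs) ≡ T.μ (λ ω → run (T.tree ω) (encode f) ≡ b)
    μ-pass f xs b none = sym (T.μ-≐ (pass-≐ f xs b none) (T.measurable (encode f) b))

    run-violated : ∀ f xs → does (any? (violates? f) xs) ≡ true → ∀ ω → run (tree (xs , ω)) f ≡ false
    run-violated f xs some ω = trans (run-tree f xs ω)
      (cong (λ c → if c then false else run (T.tree ω) (encode f)) some)

    μ-violated : ∀ f xs → does (any? (violates? f) xs) ≡ true → T.μ (outcome f false xs) ≡ 1#
    μ-violated f xs some = μ-certain T.space (run-violated f xs some)

    -- For fixed sample points the outcome is either that of the given tester on `encode f` or
    -- constantly `false`, and both give measurable events.
    measurable : ∀ f b xs → T.Measurable (outcome f b xs)
    measurable f b xs with does (any? (violates? f) xs) in found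
    ... | false = T.measurable-≐ (pass-≐ f xs b found) (T.measurable (encode f) b)
    ... | true  = T.measurable-≐
      ((λ {ω} eq → trans (run-violated f xs found ω) eq) , (λ {ω} eq → trans (sym (run-violated f xs found ω)) eq))
      (measurable-const T.space (false Bool.≟ b))

    bounded : ∀ f ω → fromℕ (#queries (tree ω) f) ≤ fromℕ Q + fromℕ 10 / ε
    bounded f (xs , ω) = begin
      fromℕ (#queries (tree (xs , ω)) f)
        ≤⟨ fromℕ-mono-≤ (s≤s (#queries-screen (f (top d)) xs _ f)) ⟩
      fromℕ (suc k ℕ.+ #queries (pullback (embed B (f (top d))) (T.tree ω)) f)
        ≡⟨ cong (λ j → fromℕ (suc k ℕ.+ j)) (#queries-pullback (embed B (f (top d))) (T.tree ω) f) ⟩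
      fromℕ (suc k ℕ.+ #queries (T.tree ω) (encode f))
        ≡⟨ fromℕ-+ (suc k) _ ⟩
      fromℕ (suc k) + fromℕ (#queries (T.tree ω) (encode f))
        ≤⟨ +-mono-≤ 1+k≤10/ε (T.bounded (encode f) ω) ⟩
      fromℕ 10 / ε + fromℕ Q
        ≡⟨ +-comm _ _ ⟩
      fromℕ Q + fromℕ 10 / ε ∎

    no-violation : ∀ f → Monotone f → ∀ xs → does (any? (violates? f) xs) ≡ false
    no-violation f f-mono xs = dec-false (any? (violates? f) xs) λ some →
      let (x , top<x) = satisfied some in ℕ.<⇒≱ top<x (f-mono x (top d) (x≤top x))

    rejects : ∀ f → Far _≟ℕ_ D Monotone (fromℕ 2 * ε) f →
              fromℕ 2 / fromℕ 3 < 𝔼 sample (λ xs → T.μ (outcome f false xs))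
    rejects f far with Pr D (violates? f) ≤? ε
    ... | no Pr≰ε = <-≤-trans (hits (violates? f) (≰⇒> Pr≰ε)) (𝔼-mono sample 𝟙≤μ)
      where
      𝟙≤μ : ∀ xs → 𝟙 (any? (violates? f) xs) ≤ T.μ (outcome f false xs)
      𝟙≤μ xs with does (any? (violates? f) xs) in found
      ... | true  = ≤-reflexive (sym (μ-violated f xs found))
      ... | false = T.μ-nonNeg (measurable f false xs)
    ... | yes Pr≤ε = both (≤-total 1# c)
      where
      c = T.μ (λ ω → run (T.tree ω) (encode f) ≡ false)
      2/3<c : fromℕ 2 / fromℕ 3 < c
      2/3<c = T.rejects (encode f) (embed-far (f (top d)) f Pr≤ε far)
      ≤μ : ∀ {t} → t ≤ 1# → t ≤ c → ∀ xs → t ≤ T.μ (outcome f false xs)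
      ≤μ t≤1 t≤c xs with does (any? (violates? f) xs) in found
      ... | true  = ≤-trans t≤1 (≤-reflexive (sym (μ-violated f xs found)))
      ... | false = ≤-trans t≤c (≤-reflexive (sym (μ-pass f xs false found)))
      -- Every sample contributes either 1, when a violation is found, or `c`, so the average is at
      -- least the smaller of the two. Both orders of `1#` and `c` are handled, which spares a proof
      -- that probabilities are at most 1.
      both : 1# ≤ c ⊎ c ≤ 1# → _
      both (inj₁ 1≤c) = <-≤-trans 2/3<1 (𝔼-≥ sample (≤μ ≤-refl 1≤c))
      both (inj₂ c≤1) = <-≤-trans 2/3<c (𝔼-≥ sample (≤μ c≤1 ≤-refl))

theorem5p4 : (R : RealNumbers) → let open PropertyTesting R in
    (m d : ℕ) (D : ProductDistribution (suc m) d) (B : BoundingFamily m d)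
    (Q : ℕ) (ε : ℝ) → 0# < ε →
    Tester _≟_ D (𝒫 B) ε (fromℕ Q) →
    Tester _≟ℕ_ D Monotone (fromℕ 2 * ε) (fromℕ Q + fromℕ 10 / ε)
theorem5p4 R m d D B Q ε 0<ε T = construct (≤-total 1# ε)
  where
  open PropertyTesting R
  open OrderedField R
  open Expectations R
  open Reduction R D B

  construct : 1# ≤ ε ⊎ ε ≤ 1# →
              Tester _≟ℕ_ D Monotone (fromℕ 2 * ε) (fromℕ Q + fromℕ 10 / ε)
  construct (inj₁ 1≤ε) = trivialTester 1≤ε
    (≤-trans (fromℕ-nonNeg Q) (x≤x+y (fromℕ Q) (proj₁ (/-pos (fromℕ-pos 9) 0<ε))))
    (Tester.space T)
  -- Here `ε ≤ 1#` makes `10 / ε` at least 1, so the budget covers the query of the top point.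
  construct (inj₂ ε≤1) = samplingTester Q 0<ε (sampler D ε 0<ε ε≤1) T
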